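{- Let $B_{\mathrm{unl}}(x,y)=\sum_{i,j\ge0}b_{i,j}x^iy^j$, where $b_{i,j}$ is the number of isomorphism classes of bicoloured graphs with $i$ vertices in the first colour class and $j$ in the second, and let $T_{\mathrm{unl}}(x,y)=\sum_{i,j\ge0}\tau_{i,j}x^iy^j$, where $\tau_{i,j}$ is the number of isomorphism classes of tangles with $i$ vertices in the first colour class and $j$ in the second. Then \[T_{\mathrm{unl}}(x,y)=1-x-y-B_{\mathrm{unl}}(x,y)^{ -1}.\]
   Context: A bicoloured graph is a triple $G=(V_1,V_2,E)$ with $V_1,V_2$ disjoint finite sets (ordered colour classes) and $E\subseteq V_1\times V_2$; isomorphisms are graph isomorphisms mapping $V_1$ to $V_1$ and $V_2$ to $V_2$. For a vertex $u$ let $N(u)$ be its set of neighbours. $G$ is called a tangle if $|V_1|\ge2$, $|V_2|\ge2$, the graph on $V_2$ joining $a,b$ whenever neither of $N(a),N(b)$ contains the other is connected, and the graph on $V_1$ defined by the same rule is connected. (Equivalently, viewing $G$ as the poset on $V_1\cup V_2$ with $u<w$ iff $u\in V_1,w\in V_2$, $(u,w)\in E$, the whole poset is a single tangle, i.e. a component of $(2+2)$-connectedness with top $V_2$ and bottom $V_1$.) -}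

module Defs where

open import Data.Bool using (Bool; T)
import Data.Bool.Properties as Bool
open import Data.Fin using (Fin; toℕ; finToFun; funToFin)
import Data.Fin as Fin using (zero; suc)
import Data.Fin.Properties as Fin
open import Data.Fin.Permutation as Perm using (Permutation′; permutation; _⟨$⟩ʳ_; _⟨$⟩ˡ_)
open import Data.Integer using (ℤ; +_; _-_; _*_; 0ℤ; 1ℤ)
import Data.Integer.Properties as ℤ
open import Algebra.Properties.CommutativeMonoid.Sum ℤ.+-0-commutativeMonoid using (sum⁺-syntax)
open import Data.List using (List; []; _∷_; length; lookup; tabulate; allFin; deduplicate)
open import Data.List.Membership.Propositional.Properties using (∈-allFin; ∈-lookup)
import Data.List.Membership.Setoid as SetoidMembership
import Data.List.Membership.Setoid.Properties as Membership
open import Data.List.Membership.Propositional using (_∈_)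
open import Data.List.Relation.Unary.All as All using ()
open import Data.List.Relation.Unary.AllPairs using ([]; _∷_)
open import Data.List.Relation.Unary.Any using (here; there)
open import Data.List.Relation.Unary.Enumerates.Setoid using (IsEnumeration)
open import Data.List.Relation.Unary.Enumerates.Setoid.Properties using (deduplicate⁺; lookup-surjective)
open import Data.List.Relation.Unary.Unique.DecSetoid.Properties using (deduplicate-!)
open import Data.List.Relation.Unary.Unique.Setoid using (Unique)
open import Data.Nat using (ℕ; _∸_; _^_; _≤_; _≤?_)
open import Data.Product using (Σ; ∃; _×_; _,_; proj₁; proj₂)
open import Data.Sum using (_⊎_; inj₁; inj₂)
open import Function using (_∘_; Bijection; Inverse)
open import Level using (0ℓ)
open import Relation.Binary using (Rel; Setoid; DecSetoid; Decidable)
open import Relation.Binary.Construct.Closure.ReflexiveTransitive using (Star; ε; _◅_; _◅◅_; gmap)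
import Relation.Binary.Construct.On as On
open import Relation.Binary.PropositionalEquality as ≡ using (_≡_; refl; sym; trans; cong; cong₂; subst; subst₂)
open import Relation.Nullary using (Dec; yes; no; ¬_; ¬?; contradiction)
open import Relation.Nullary.Decidable using (map′; _×-dec_; _⊎-dec_; _→-dec_)
open import Relation.Unary using (Pred; _⊆_)

-- Only the cardinalities of the colour classes matter up to isomorphism, so
-- the classes are taken to be Fin m and Fin n; being separate types, they are
-- disjoint.
record BicolouredGraph (m n : ℕ) : Set where
  constructor graph
  field
    edge : Fin m → Fin n → Bool

  N₁ : Fin m → Pred (Fin n) 0ℓ
  N₁ u w = T (edge u w)

  N₂ : Fin n → Pred (Fin m) 0ℓ
  N₂ w u = T (edge u w)

open BicolouredGraph public

record _≅_ {m n : ℕ} (G H : BicolouredGraph m n) : Set where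
  constructor iso
  field
    φ₁ : Permutation′ m
    φ₂ : Permutation′ n
    preserves : ∀ u w → edge G u w ≡ edge H (φ₁ ⟨$⟩ʳ u) (φ₂ ⟨$⟩ʳ w)

open _≅_ public

Incomparable : {V W : Set} → (V → Pred W 0ℓ) → Rel V 0ℓ
Incomparable N a b = ¬ (N a ⊆ N b) × ¬ (N b ⊆ N a)

-- Star R a b is the type of R-walks from a to b; R is symmetric where this is
-- used.
Connected : {V : Set} → Rel V 0ℓ → Set
Connected R = ∀ a b → Star R a b

record IsTangle {m n : ℕ} (G : BicolouredGraph m n) : Set where
  field
    2≤m  : 2 ≤ m
    2≤n  : 2 ≤ n
    con₂ : Connected (Incomparable (N₂ G))
    con₁ : Connected (Incomparable (N₁ G))

open IsTangle public

≅-refl : ∀ {m n} {G : BicolouredGraph m n} → G ≅ G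
≅-refl = iso Perm.id Perm.id λ _ _ → refl

≅-sym : ∀ {m n} {G H : BicolouredGraph m n} → G ≅ H → H ≅ G
≅-sym {H = H} (iso φ ψ p) = iso (Perm.flip φ) (Perm.flip ψ) λ u w →
  sym (trans (p (φ ⟨$⟩ˡ u) (ψ ⟨$⟩ˡ w)) (cong₂ (edge H) (Perm.inverseʳ φ) (Perm.inverseʳ ψ)))

≅-trans : ∀ {m n} {G H K : BicolouredGraph m n} → G ≅ H → H ≅ K → G ≅ K
≅-trans (iso φ ψ p) (iso φ′ ψ′ p′) = iso (φ Perm.∘ₚ φ′) (ψ Perm.∘ₚ ψ′) λ u w →
  trans (p u w) (p′ (φ ⟨$⟩ʳ u) (ψ ⟨$⟩ʳ w))

graphSetoid : ℕ → ℕ → Setoid 0ℓ 0ℓ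
graphSetoid m n = record
  { Carrier       = BicolouredGraph m n
  ; _≈_           = _≅_
  ; isEquivalence = record { refl = ≅-refl ; sym = ≅-sym ; trans = ≅-trans }
  }

tangleSetoid : ℕ → ℕ → Setoid 0ℓ 0ℓ
tangleSetoid m n = On.setoid {B = Σ (BicolouredGraph m n) IsTangle} (graphSetoid m n) proj₁

-- A setoid plays the role of the quotient of its carrier, so this says that
-- there are exactly k equivalence classes.
HasSize : Setoid 0ℓ 0ℓ → ℕ → Set
HasSize S k = Bijection (≡.setoid (Fin k)) S

lookup-injective : (S : Setoid 0ℓ 0ℓ) → ∀ {xs} → Unique S xs →
                   ∀ {i j} → Setoid._≈_ S (lookup xs i) (lookup xs j) → i ≡ j
lookup-injective S (p ∷ ps) {Fin.zero}  {Fin.zero}  e = refl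
lookup-injective S (p ∷ ps) {Fin.zero}  {Fin.suc j} e = contradiction e (All.lookup p (∈-lookup j))
lookup-injective S (p ∷ ps) {Fin.suc i} {Fin.zero}  e = contradiction (Setoid.sym S e) (All.lookup p (∈-lookup i))
lookup-injective S (p ∷ ps) {Fin.suc i} {Fin.suc j} e = cong Fin.suc (lookup-injective S ps e)

countClasses : (S? : DecSetoid 0ℓ 0ℓ) → let S = DecSetoid.setoid S? in
               ∀ xs → IsEnumeration S xs → ∃ (HasSize S)
countClasses S? xs enum = length reps , record
  { to        = lookup reps
  ; cong      = λ { refl → DecSetoid.refl S? }
  ; bijective = lookup-injective S (deduplicate-! S? xs) , lookup-surjective S (deduplicate⁺ S? enum)
  }
  where
  S    = DecSetoid.setoid S?
  reps = deduplicate (DecSetoid._≟_ S?) xs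

-- Warshall's algorithm: Reach R vs a b says that there is an R-walk from a to b
-- all of whose intermediate vertices are in vs.
module _ {n : ℕ} (R : Rel (Fin n) 0ℓ) (R? : Decidable R) where

  Reach : List (Fin n) → Rel (Fin n) 0ℓ
  Reach []       a b = a ≡ b ⊎ R a b
  Reach (v ∷ vs) a b = Reach vs a b ⊎ (Reach vs a v × Reach vs v b)

  reach? : ∀ vs → Decidable (Reach vs)
  reach? []       a b = (a Fin.≟ b) ⊎-dec R? a b
  reach? (v ∷ vs) a b = reach? vs a b ⊎-dec (reach? vs a v ×-dec reach? vs v b)

  reach⇒star : ∀ vs {a b} → Reach vs a b → Star R a b
  reach⇒star []       (inj₁ refl)    = ε
  reach⇒star []       (inj₂ r)       = r ◅ ε
  reach⇒star (v ∷ vs) (inj₁ p)       = reach⇒star vs p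
  reach⇒star (v ∷ vs) (inj₂ (p , q)) = reach⇒star vs p ◅◅ reach⇒star vs q

  reach-base : ∀ vs {a b} → a ≡ b ⊎ R a b → Reach vs a b
  reach-base []       p = p
  reach-base (v ∷ vs) p = inj₁ (reach-base vs p)

  reach-join : ∀ vs {a w b} → w ∈ vs → Reach vs a w → Reach vs w b → Reach vs a b
  reach-join (v ∷ vs) (here refl) p q = inj₂ (toHead p , fromHead q)
    where
    toHead : ∀ {a} → Reach (v ∷ vs) a v → Reach vs a v
    toHead (inj₁ p)       = p
    toHead (inj₂ (p , _)) = p
    fromHead : ∀ {b} → Reach (v ∷ vs) v b → Reach vs v b
    fromHead (inj₁ p)       = p
    fromHead (inj₂ (_ , p)) = p
  reach-join (v ∷ vs) (there i) (inj₁ p)        (inj₁ q)        = inj₁ (reach-join vs i p q)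
  reach-join (v ∷ vs) (there i) (inj₁ p)        (inj₂ (q , q′)) = inj₂ (reach-join vs i p q , q′)
  reach-join (v ∷ vs) (there i) (inj₂ (p , p′)) (inj₁ q)        = inj₂ (p , reach-join vs i p′ q)
  reach-join (v ∷ vs) (there i) (inj₂ (p , _))  (inj₂ (_ , q′)) = inj₂ (p , q′)

  star⇒reach : ∀ {a b} → Star R a b → Reach (allFin n) a b
  star⇒reach ε        = reach-base (allFin n) (inj₁ refl)
  star⇒reach (r ◅ rs) = reach-join (allFin n) (∈-allFin _) (reach-base (allFin n) (inj₂ r)) (star⇒reach rs)

  connected? : Dec (Connected R)
  connected? = Fin.all? λ a → Fin.all? λ b →
    map′ (reach⇒star (allFin n)) star⇒reach (reach? (allFin n) a b)

incomparable? : ∀ {k l} {N : Fin k → Pred (Fin l) 0ℓ} → Decidable N → Decidable (Incomparable N)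
incomparable? {N = N} N? a b = ¬? (a ⊆? b) ×-dec ¬? (b ⊆? a)
  where
  _⊆?_ : ∀ a b → Dec (N a ⊆ N b)
  a ⊆? b = map′ (λ f {x} → f x) (λ f x → f {x}) (Fin.all? λ x → N? a x →-dec N? b x)

isTangle? : ∀ {m n} (G : BicolouredGraph m n) → Dec (IsTangle G)
isTangle? {m} {n} G =
  map′ (λ (a , b , c , d) → record { 2≤m = a ; 2≤n = b ; con₂ = c ; con₁ = d })
       (λ t → 2≤m t , 2≤n t , con₂ t , con₁ t)
       (2 ≤? m ×-dec 2 ≤? n
         ×-dec connected? _ (incomparable? λ w u → Bool.T? (edge G u w))
         ×-dec connected? _ (incomparable? λ u w → Bool.T? (edge G u w)))

IsTangle-resp-≅ : ∀ {m n} {G H : BicolouredGraph m n} → G ≅ H → IsTangle G → IsTangle H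
IsTangle-resp-≅ {G = G} {H} (iso φ ψ p) t = record
  { 2≤m  = 2≤m t
  ; 2≤n  = 2≤n t
  ; con₂ = λ a b → subst₂ (Star _) (Perm.inverseʳ ψ) (Perm.inverseʳ ψ)
             (gmap (ψ ⟨$⟩ʳ_) (λ (x , y) → x ∘ back₂ , y ∘ back₂) (con₂ t (ψ ⟨$⟩ˡ a) (ψ ⟨$⟩ˡ b)))
  ; con₁ = λ a b → subst₂ (Star _) (Perm.inverseʳ φ) (Perm.inverseʳ φ)
             (gmap (φ ⟨$⟩ʳ_) (λ (x , y) → x ∘ back₁ , y ∘ back₁) (con₁ t (φ ⟨$⟩ˡ a) (φ ⟨$⟩ˡ b)))
  }
  where
  back₂ : ∀ {a b} → N₂ H (ψ ⟨$⟩ʳ a) ⊆ N₂ H (ψ ⟨$⟩ʳ b) → N₂ G a ⊆ N₂ G b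
  back₂ {a} {b} s {u} e = subst T (sym (p u b)) (s (subst T (p u a) e))
  back₁ : ∀ {a b} → N₁ H (φ ⟨$⟩ʳ a) ⊆ N₁ H (φ ⟨$⟩ʳ b) → N₁ G a ⊆ N₁ G b
  back₁ {a} {b} s {w} e = subst T (sym (p b w)) (s (subst T (p a w) e))

_≅?_ : ∀ {m n} → Decidable (_≅_ {m} {n})
_≅?_ {m} {n} G H = map′ to from
  (Fin.any? λ f → Fin.any? λ f′ → Fin.any? λ g → Fin.any? λ g′ → good? f f′ g g′)
  where
  Good : Fin (m ^ m) → Fin (m ^ m) → Fin (n ^ n) → Fin (n ^ n) → Set
  Good f f′ g g′ =
      (∀ u → finToFun {m} {m} f (finToFun f′ u) ≡ u) × (∀ u → finToFun {m} {m} f′ (finToFun f u) ≡ u)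
    × (∀ w → finToFun {n} {n} g (finToFun g′ w) ≡ w) × (∀ w → finToFun {n} {n} g′ (finToFun g w) ≡ w)
    × (∀ u w → edge G u w ≡ edge H (finToFun f u) (finToFun g w))
  good? : ∀ f f′ g g′ → Dec (Good f f′ g g′)
  good? f f′ g g′ =
            Fin.all? (λ _ → _ Fin.≟ _) ×-dec Fin.all? (λ _ → _ Fin.≟ _)
      ×-dec Fin.all? (λ _ → _ Fin.≟ _) ×-dec Fin.all? (λ _ → _ Fin.≟ _)
      ×-dec Fin.all? (λ _ → Fin.all? λ _ → _ Bool.≟ _)
  to : (∃ λ f → ∃ λ f′ → ∃ λ g → ∃ λ g′ → Good f f′ g g′) → G ≅ H
  to (f , f′ , g , g′ , a , b , c , d , e) =
    iso (permutation (finToFun f) (finToFun f′) a b) (permutation (finToFun g) (finToFun g′) c d) e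
  code-inv : ∀ {k} (f g : Fin k → Fin k) → (∀ {x} → f (g x) ≡ x) →
             ∀ x → finToFun (funToFin f) (finToFun (funToFin g) x) ≡ x
  code-inv f g inv x = trans (Fin.finToFun-funToFin f _) (trans (cong f (Fin.finToFun-funToFin g x)) inv)
  from : G ≅ H → ∃ λ f → ∃ λ f′ → ∃ λ g → ∃ λ g′ → Good f f′ g g′
  from (iso φ ψ p) =
      funToFin (φ ⟨$⟩ʳ_) , funToFin (φ ⟨$⟩ˡ_) , funToFin (ψ ⟨$⟩ʳ_) , funToFin (ψ ⟨$⟩ˡ_)
    , code-inv _ _ (Perm.inverseʳ φ) , code-inv _ _ (Perm.inverseˡ φ)
    , code-inv _ _ (Perm.inverseʳ ψ) , code-inv _ _ (Perm.inverseˡ ψ)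
    , λ u w → trans (p u w) (sym (cong₂ (edge H) (Fin.finToFun-funToFin (φ ⟨$⟩ʳ_) u)
                                                 (Fin.finToFun-funToFin (ψ ⟨$⟩ʳ_) w)))

graphDecSetoid : ℕ → ℕ → DecSetoid 0ℓ 0ℓ
graphDecSetoid m n = record
  { isDecEquivalence = record { isEquivalence = Setoid.isEquivalence (graphSetoid m n) ; _≟_ = _≅?_ } }

tangleDecSetoid : ℕ → ℕ → DecSetoid 0ℓ 0ℓ
tangleDecSetoid m n = record
  { isDecEquivalence = record
      { isEquivalence = Setoid.isEquivalence (tangleSetoid m n) ; _≟_ = λ (G , _) (H , _) → G ≅? H } }

decode : ∀ {m n} → Fin ((2 ^ n) ^ m) → BicolouredGraph m n
decode c = graph λ u w → Inverse.to Fin.2↔Bool (finToFun (finToFun c u) w)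

encode : ∀ {m n} → BicolouredGraph m n → Fin ((2 ^ n) ^ m)
encode G = funToFin λ u → funToFin λ w → Inverse.from Fin.2↔Bool (edge G u w)

decode-encode : ∀ {m n} (G : BicolouredGraph m n) → G ≅ decode (encode G)
decode-encode {m} {n} G = iso Perm.id Perm.id λ u w → sym (trans
  (cong (Inverse.to Fin.2↔Bool) (trans
    (cong (λ c → finToFun c w) (Fin.finToFun-funToFin {m} row u))
    (Fin.finToFun-funToFin {n} (λ w → Inverse.from Fin.2↔Bool (edge G u w)) w)))
  (Inverse.inverseˡ Fin.2↔Bool refl))
  where
  row : Fin m → Fin (2 ^ n)
  row u = funToFin λ w → Inverse.from Fin.2↔Bool (edge G u w)

allGraphs : ∀ m n → List (BicolouredGraph m n)
allGraphs m n = tabulate decode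

allGraphs-enumerates : ∀ m n → IsEnumeration (graphSetoid m n) (allGraphs m n)
allGraphs-enumerates m n G =
  Membership.∈-resp-≈ (graphSetoid m n) (≅-sym (decode-encode G))
    (Membership.∈-tabulate⁺ (graphSetoid m n) (encode G))

keepTangles : ∀ {m n} → List (BicolouredGraph m n) → List (Σ (BicolouredGraph m n) IsTangle)
keepTangles []       = []
keepTangles (G ∷ Gs) with isTangle? G
... | yes t = (G , t) ∷ keepTangles Gs
... | no  _ = keepTangles Gs

∈-keepTangles : ∀ {m n} (H : Σ (BicolouredGraph m n) IsTangle) Gs →
                SetoidMembership._∈_ (graphSetoid m n) (proj₁ H) Gs →
                SetoidMembership._∈_ (tangleSetoid m n) H (keepTangles Gs)
∈-keepTangles H (G ∷ Gs) i with isTangle? G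
∈-keepTangles H (G ∷ Gs) (here p)  | yes t = here p
∈-keepTangles H (G ∷ Gs) (there i) | yes t = there (∈-keepTangles H Gs i)
∈-keepTangles H (G ∷ Gs) (here p)  | no ¬t = contradiction (IsTangle-resp-≅ p (proj₂ H)) ¬t
∈-keepTangles H (G ∷ Gs) (there i) | no ¬t = ∈-keepTangles H Gs i

countGraphs : ∀ m n → ∃ (HasSize (graphSetoid m n))
countGraphs m n = countClasses (graphDecSetoid m n) (allGraphs m n) (allGraphs-enumerates m n)

countTangles : ∀ m n → ∃ (HasSize (tangleSetoid m n))
countTangles m n = countClasses (tangleDecSetoid m n) (keepTangles (allGraphs m n))
  λ H → ∈-keepTangles H (allGraphs m n) (allGraphs-enumerates m n (proj₁ H))

b : ℕ → ℕ → ℕ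
b i j = proj₁ (countGraphs i j)

τ : ℕ → ℕ → ℕ
τ i j = proj₁ (countTangles i j)

-- F i j is the coefficient of xⁱyʲ.
Series : Set
Series = ℕ → ℕ → ℤ

infix  4 _≈ˢ_
infixl 6 _-ˢ_
infixl 7 _*ˢ_

_≈ˢ_ : Rel Series 0ℓ
F ≈ˢ G = ∀ i j → F i j ≡ G i j

_-ˢ_ : Series → Series → Series
(F -ˢ G) i j = F i j - G i j

_*ˢ_ : Series → Series → Series
(F *ˢ G) i j = ∑[ k ≤ i ] ∑[ l ≤ j ] (F (toℕ k) (toℕ l) * G (i ∸ toℕ k) (j ∸ toℕ l))

1ˢ : Series
1ˢ 0 0 = 1ℤ
1ˢ _ _ = 0ℤ

xˢ : Series
xˢ 1 0 = 1ℤ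
xˢ _ _ = 0ℤ

yˢ : Series
yˢ 0 1 = 1ℤ
yˢ _ _ = 0ℤ

Bunl : Series
Bunl i j = + b i j

Tunl : Series
Tunl i j = + τ i j

{-# OPTIONS --safe #-}
-- Write E ⊞ F for the ordered sum of two bicoloured graphs: every first-class vertex of E is joined to
-- every second-class vertex of F, and no first-class vertex of F to a second-class vertex of E.  Call
-- blocks the one-vertex graphs and the tangles.  Every nonempty graph is block ⊞ rest, and both parts
-- are unique up to isomorphism, so B = 1 + (x + y + T) B.
--
-- Existence: if the incomparability graph of a colour class is disconnected, its components are linearly
-- ordered by inclusion of neighbourhoods, and an initial set of components cuts the graph into a sum.
-- Uniqueness: a block is not itself a proper sum, so an isomorphism between block ⊞ rest and
-- block′ ⊞ rest′ either identifies the blocks or moves each off the other; the latter is possible only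
-- for two points of the same class, which are then twins.
module Submission where

open import Defs
open import Algebra.Definitions _≈ˢ_ using (Invertible)
open import Data.Bool using (Bool; T; false; not; true)
import Data.Bool.Properties as Bool
open import Data.Empty using (⊥; ⊥-elim)
open import Data.Fin using (Fin; fromℕ<; opposite; suc; toℕ; zero)
open import Data.Fin.Permutation using (reverse; ↔⇒≡)
import Data.Fin.Properties as Fin
open import Data.Integer as ℤ using (+_; 0ℤ; 1ℤ; ℤ)
import Data.Integer.Properties as ℤ
open import Data.Integer.Tactic.RingSolver using (solve-∀)
open import Data.List using (allFin)
open import Data.Nat as ℕ using (_+_; _<_; _∸_; _≤_; suc; s≤s; zero; z≤n; ℕ)
open import Data.Nat.Induction using (<-wellFounded)
import Data.Nat.Properties as ℕ
open import Data.Product using (_,_; _×_; proj₁; proj₂; Σ; Σ-syntax; ∃; ∃₂)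
open import Data.Product.Function.Dependent.Propositional using (Σ-↔)
open import Data.Sum as Sum using (_⊎_; inj₁; inj₂)
open import Data.Sum.Algebra using (⊎-assoc; ⊎-comm)
open import Data.Sum.Function.Propositional using (_⊎-↔_)
open import Data.Sum.Properties using (inj₁-injective; inj₂-injective)
open import Function using (Bijection; Inverse; _↔_; _∘_; mk↔ₛ′)
open import Function.Construct.Composition using (_↔-∘_)
open import Function.Construct.Identity using (↔-id)
open import Function.Construct.Symmetry using (↔-sym)
open import Induction.WellFounded using (Acc; acc)
open import Level using (0ℓ)
open import Relation.Binary using (Decidable; Setoid)
open import Relation.Binary.Construct.Closure.ReflexiveTransitive using (Star; _◅_; _◅◅_; ε)
import Relation.Binary.Construct.On as On
open import Relation.Binary.PropositionalEquality using (_≡_; _≢_; cong; cong₂; module ≡-Reasoning; refl; subst; subst₂; sym; trans)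
open import Relation.Nullary using (Dec; contradiction; does; no; yes; ¬?; ¬_)
open import Relation.Nullary.Decidable using (_×-dec_; _→-dec_; _⊎-dec_; dec-false; dec-true; decidable-stable; map′)
open import Relation.Unary using (Pred; _⊆_)
open import Algebra.Properties.AbelianGroup ℤ.+-0-abelianGroup using () renaming (∙-cancelʳ to +-cancelʳ)
open import Algebra.Properties.CommutativeMonoid.Sum ℕ.+-0-commutativeMonoid using () renaming (sum to sumℕ)
open import Algebra.Properties.CommutativeMonoid.Sum ℤ.+-0-commutativeMonoid using (sum; sum-cong-≗; sum-permute; sum-replicate-zero; ∑-distrib-+)

open Inverse using (to; from; strictlyInverseˡ; strictlyInverseʳ)

private variable
  A A′ A″ B B′ B″ C D X Y : Set
  k k′ l l′ m m′ n n′ : ℕ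

-- Isomorphisms of bipartite relations and the ordered sum

true≢false : ∀ {x} → x ≡ true → x ≡ false → X
true≢false refl ()

-- The vertex classes are arbitrary types, unlike in `_≅_`: sums can then live on disjoint unions,
-- and graphs of different sizes can be compared before their sizes are known to agree.
record _≃_ (E : A → B → Bool) (E′ : A′ → B′ → Bool) : Set where
  constructor rel-iso
  field
    left     : A ↔ A′
    right    : B ↔ B′
    respects : ∀ u w → E u w ≡ E′ (to left u) (to right w)

open _≃_

infix 4 _≃_

≃-refl : {E : A → B → Bool} → E ≃ E
≃-refl = rel-iso (↔-id _) (↔-id _) λ _ _ → refl

≃-sym : {E : A → B → Bool} {E′ : A′ → B′ → Bool} → E ≃ E′ → E′ ≃ E
≃-sym {E′ = E′} (rel-iso f g r) = rel-iso (↔-sym f) (↔-sym g) λ u w →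
  sym (trans (r _ _) (cong₂ E′ (strictlyInverseˡ f u) (strictlyInverseˡ g w)))

≃-trans : {E : A → B → Bool} {E′ : A′ → B′ → Bool} {E″ : A″ → B″ → Bool} → E ≃ E′ → E′ ≃ E″ → E ≃ E″
≃-trans (rel-iso f g r) (rel-iso f′ g′ r′) = rel-iso (f′ ↔-∘ f) (g′ ↔-∘ g) λ u w →
  trans (r u w) (r′ _ _)

≃⇒≅ : {G H : BicolouredGraph m n} → edge G ≃ edge H → G ≅ H
≃⇒≅ (rel-iso f g r) = iso f g r

≅⇒≃ : {G H : BicolouredGraph m n} → G ≅ H → edge G ≃ edge H
≅⇒≃ (iso f g r) = rel-iso f g r

infixr 5 _⊞_

_⊞_ : (A → B → Bool) → (C → D → Bool) → (A ⊎ C) → (B ⊎ D) → Bool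
(E ⊞ F) (inj₁ u) (inj₁ w) = E u w
(E ⊞ F) (inj₁ u) (inj₂ w) = true
(E ⊞ F) (inj₂ u) (inj₁ w) = false
(E ⊞ F) (inj₂ u) (inj₂ w) = F u w

⊞-cong : {E : A → B → Bool} {E′ : A′ → B′ → Bool} {F : C → D → Bool} {F′ : X → Y → Bool} →
         E ≃ E′ → F ≃ F′ → E ⊞ F ≃ E′ ⊞ F′
⊞-cong (rel-iso f g r) (rel-iso f′ g′ r′) = rel-iso (f ⊎-↔ f′) (g ⊎-↔ g′) λ where
  (inj₁ u) (inj₁ w) → r u w
  (inj₁ u) (inj₂ w) → refl
  (inj₂ u) (inj₁ w) → refl
  (inj₂ u) (inj₂ w) → r′ u w

⊞-assoc : (E : A → B → Bool) (F : C → D → Bool) (K : X → Y → Bool) → (E ⊞ F) ⊞ K ≃ E ⊞ (F ⊞ K)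
⊞-assoc E F K = rel-iso (⊎-assoc 0ℓ _ _ _) (⊎-assoc 0ℓ _ _ _) λ where
  (inj₁ (inj₁ u)) (inj₁ (inj₁ w)) → refl
  (inj₁ (inj₁ u)) (inj₁ (inj₂ w)) → refl
  (inj₁ (inj₁ u)) (inj₂ w)        → refl
  (inj₁ (inj₂ u)) (inj₁ (inj₁ w)) → refl
  (inj₁ (inj₂ u)) (inj₁ (inj₂ w)) → refl
  (inj₁ (inj₂ u)) (inj₂ w)        → refl
  (inj₂ u)        (inj₁ (inj₁ w)) → refl
  (inj₂ u)        (inj₁ (inj₂ w)) → refl
  (inj₂ u)        (inj₂ w)        → refl

infixr 5 _⊕_

_⊕_ : BicolouredGraph k l → BicolouredGraph k′ l′ → BicolouredGraph (k + k′) (l + l′)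
G ⊕ H = graph λ u w → (edge G ⊞ edge H) (to Fin.+↔⊎ u) (to Fin.+↔⊎ w)

⊕≃⊞ : (G : BicolouredGraph k l) (H : BicolouredGraph k′ l′) → edge (G ⊕ H) ≃ edge G ⊞ edge H
⊕≃⊞ G H = rel-iso Fin.+↔⊎ Fin.+↔⊎ λ _ _ → refl

-- Blocks admit no proper cut

record IsCut (E : A → B → Bool) (S : A → Bool) (R : B → Bool) : Set where
  field
    full  : ∀ {u w} → S u ≡ true  → R w ≡ false → E u w ≡ true
    empty : ∀ {u w} → S u ≡ false → R w ≡ true  → E u w ≡ false

open IsCut

data IsBlock {m n} (G : BicolouredGraph m n) : Set where
  point₁ : m ≡ 1 → n ≡ 0 → IsBlock G
  point₂ : m ≡ 0 → n ≡ 1 → IsBlock G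
  tangle : IsTangle G → IsBlock G

Constant : Bool → (A → Bool) → Set
Constant c S = ∀ u → S u ≡ c

star-constant : {N : A → Pred B 0ℓ} (S : A → Bool) →
                (∀ {a c} → S a ≢ S c → ¬ Incomparable N a c) →
                ∀ {a c} → Star (Incomparable N) a c → S a ≡ S c
star-constant S cmp ε        = refl
star-constant S cmp (r ◅ rs) =
  trans (decidable-stable (_ Bool.≟ _) (λ ne → cmp ne r)) (star-constant S cmp rs)

different : ∀ {x y} → x ≢ y → (x ≡ true × y ≡ false) ⊎ (x ≡ false × y ≡ true)
different {true}  {true}  ne = contradiction refl ne
different {true}  {false} ne = inj₁ (refl , refl)
different {false} {true}  ne = inj₂ (refl , refl)
different {false} {false} ne = contradiction refl ne

T⇒true : ∀ {x} → T x → x ≡ true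
T⇒true {true} _ = refl

true⇒T : ∀ {x} → x ≡ true → T x
true⇒T refl = _

connected-step : {N : Fin (suc (suc n)) → Pred B 0ℓ} → Connected (Incomparable N) → ∃₂ (Incomparable N)
connected-step con with con zero (suc zero)
... | r ◅ _ = _ , _ , r

-- Neighbourhoods on different sides of a cut are comparable, so no step of a walk crosses it.
tangle-cut : {G : BicolouredGraph m n} → IsTangle G → ∀ {S R} → IsCut (edge G) S R →
             ∃ λ c → Constant c S × Constant c R
tangle-cut {suc (suc m)} {suc (suc n)} {G} t@record{ 2≤m = s≤s (s≤s _) ; 2≤n = s≤s (s≤s _) } {S} {R} cut =
  go (S zero) (R zero) (λ u → constS u zero) (λ w → constR w zero)
  where
  constS : ∀ a c → S a ≡ S c
  constS a c = star-constant S cmp (con₁ t a c)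
    where
    sub : ∀ {a c} → S a ≡ true → S c ≡ false → N₁ G c ⊆ N₁ G a
    sub p q {w} e with R w in eq
    ... | true  = true≢false (T⇒true e) (empty cut q eq)
    ... | false = true⇒T (full cut p eq)
    cmp : ∀ {a c} → S a ≢ S c → ¬ Incomparable (N₁ G) a c
    cmp ne (x , y) with different ne
    ... | inj₁ (p , q) = y (sub p q)
    ... | inj₂ (p , q) = x (sub q p)
  constR : ∀ a c → R a ≡ R c
  constR a c = star-constant R cmp (con₂ t a c)
    where
    sub : ∀ {a c} → R a ≡ true → R c ≡ false → N₂ G a ⊆ N₂ G c
    sub p q {u} e with S u in eq
    ... | true  = true⇒T (full cut eq q)
    ... | false = true≢false (T⇒true e) (empty cut eq p)
    cmp : ∀ {a c} → R a ≢ R c → ¬ Incomparable (N₂ G) a c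
    cmp ne (x , y) with different ne
    ... | inj₁ (p , q) = x (sub p q)
    ... | inj₂ (p , q) = y (sub q p)
  go : ∀ c d → Constant c S → Constant d R → ∃ λ c → Constant c S × Constant c R
  go true  true  p q = true  , p , q
  go false false p q = false , p , q
  -- If the two constants differ, the graph is complete here and edgeless in the next clause, so all
  -- first-class neighbourhoods coincide, against the incomparable pair that a first step of a walk
  -- provides.
  go true  false p q with a , _ , ¬sub , _ ← connected-step (con₁ t) =
    ⊥-elim (¬sub λ _ → true⇒T (full cut (p _) (q _)))
  go false true  p q with a , _ , ¬sub , _ ← connected-step (con₁ t) =
    ⊥-elim (¬sub λ e → true≢false (T⇒true e) (empty cut (p _) (q _)))

block-cut : {G : BicolouredGraph m n} → IsBlock G → ∀ {S R} → IsCut (edge G) S R →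
            ∃ λ c → Constant c S × Constant c R
block-cut (point₁ refl refl) {S = S} cut = S zero , (λ { zero → refl }) , λ ()
block-cut (point₂ refl refl) {R = R} cut = R zero , (λ ()) , λ { zero → refl }
block-cut (tangle t)         cut = tangle-cut t cut

-- Cancellation of the first block

isInj₁ : A ⊎ B → Bool
isInj₁ (inj₁ _) = true
isInj₁ (inj₂ _) = false

isInj₁-true : (s : A ⊎ B) → isInj₁ s ≡ true → ∃ λ a → s ≡ inj₁ a
isInj₁-true (inj₁ a) _ = a , refl

⊞-full : {E : A → B → Bool} {F : C → D → Bool} → ∀ u w →
         isInj₁ u ≡ true → isInj₁ w ≡ false → (E ⊞ F) u w ≡ true
⊞-full (inj₁ _) (inj₂ _) _ _ = refl

⊞-empty : {E : A → B → Bool} {F : C → D → Bool} → ∀ u w →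
          isInj₁ u ≡ false → isInj₁ w ≡ true → (E ⊞ F) u w ≡ false
⊞-empty (inj₂ _) (inj₁ _) _ _ = refl

-- The cut between `E′` and `F′`, pulled back to `E`. Together with `block-cut` it forces a block
-- `E` to land entirely in `E′` or entirely in `F′`.
pullback-cut : {E : A → B → Bool} {F : C → D → Bool} {E′ : A′ → B′ → Bool} {F′ : X → Y → Bool}
               (i : E ⊞ F ≃ E′ ⊞ F′) →
               IsCut E (λ u → isInj₁ (to (left i) (inj₁ u))) (λ w → isInj₁ (to (right i) (inj₁ w)))
pullback-cut i = record
  { full  = λ p q → trans (respects i _ _) (⊞-full _ _ p q)
  ; empty = λ p q → trans (respects i _ _) (⊞-empty _ _ p q)
  }

from-eq : (f : A ↔ B) {x : A} {y : B} → to f x ≡ y → from f y ≡ x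
from-eq f refl = strictlyInverseʳ f _

to-eq : (f : A ↔ B) {x : A} {y : B} → from f y ≡ x → to f x ≡ y
to-eq f refl = strictlyInverseˡ f _

Preserves₁ : (A ⊎ C) ↔ (A′ ⊎ X) → Set
Preserves₁ f = ∀ a → isInj₁ (to f (inj₁ a)) ≡ true

module _ (f : (A ⊎ C) ↔ (A′ ⊎ X)) (p : Preserves₁ f) (q : Preserves₁ (↔-sym f)) where

  private
    forth₁ : ∀ a → ∃ λ a′ → to f (inj₁ a) ≡ inj₁ a′
    forth₁ a = isInj₁-true _ (p a)
    back₁ : ∀ a′ → ∃ λ a → from f (inj₁ a′) ≡ inj₁ a
    back₁ a′ = isInj₁-true _ (q a′)
    -- A vertex of `C` cannot land in `A′`, since `back₁` returns all of `A′` to `A`.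
    forth₂ : ∀ c → ∃ λ x → to f (inj₂ c) ≡ inj₂ x
    forth₂ c with to f (inj₂ c) in eq
    ... | inj₂ x = x , refl
    ... | inj₁ a with () ← trans (sym (proj₂ (back₁ a))) (from-eq f eq)
    back₂ : ∀ x → ∃ λ c → from f (inj₂ x) ≡ inj₂ c
    back₂ x with from f (inj₂ x) in eq
    ... | inj₂ c = c , refl
    ... | inj₁ a with () ← trans (sym (proj₂ (forth₁ a))) (to-eq f eq)

  restrict₁ : Σ[ g ∈ A ↔ A′ ] ∀ a → to f (inj₁ a) ≡ inj₁ (to g a)
  restrict₁ = mk↔ₛ′ (proj₁ ∘ forth₁) (proj₁ ∘ back₁)
    (λ a′ → inj₁-injective (trans (sym (proj₂ (forth₁ _))) (to-eq f (proj₂ (back₁ a′)))))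
    (λ a → inj₁-injective (trans (sym (proj₂ (back₁ _))) (from-eq f (proj₂ (forth₁ a)))))
    , proj₂ ∘ forth₁

  restrict₂ : Σ[ g ∈ C ↔ X ] ∀ c → to f (inj₂ c) ≡ inj₂ (to g c)
  restrict₂ = mk↔ₛ′ (proj₁ ∘ forth₂) (proj₁ ∘ back₂)
    (λ x → inj₂-injective (trans (sym (proj₂ (forth₂ _))) (to-eq f (proj₂ (back₂ x)))))
    (λ c → inj₂-injective (trans (sym (proj₂ (back₂ _))) (from-eq f (proj₂ (forth₂ c)))))
    , proj₂ ∘ forth₂

restrict : {E : A → B → Bool} {F : C → D → Bool} {E′ : A′ → B′ → Bool} {F′ : X → Y → Bool}
           (i : E ⊞ F ≃ E′ ⊞ F′) →
           Preserves₁ (left i) → Preserves₁ (↔-sym (left i)) →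
           Preserves₁ (right i) → Preserves₁ (↔-sym (right i)) →
           E ≃ E′ × F ≃ F′
restrict {E′ = E′} {F′} (rel-iso f g r) p p′ q q′ =
  let f₁ , f₁-eq = restrict₁ f p p′
      f₂ , f₂-eq = restrict₂ f p p′
      g₁ , g₁-eq = restrict₁ g q q′
      g₂ , g₂-eq = restrict₂ g q q′
  in  rel-iso f₁ g₁ (λ u w → trans (r _ _) (cong₂ (E′ ⊞ F′) (f₁-eq u) (g₁-eq w)))
   ,  rel-iso f₂ g₂ (λ u w → trans (r _ _) (cong₂ (E′ ⊞ F′) (f₂-eq u) (g₂-eq w)))

-- A bijection of the sums need not fix the extra point; short-circuiting the point out of its orbit
-- still leaves a bijection C ↔ X.
ShortCircuit : (Fin 1 ⊎ C) ↔ (Fin 1 ⊎ X) → C → X → Set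
ShortCircuit f c x =
  to f (inj₂ c) ≡ inj₂ x ⊎ (to f (inj₂ c) ≡ inj₁ zero × to f (inj₁ zero) ≡ inj₂ x)

shortCircuit-total : (f : (Fin 1 ⊎ C) ↔ (Fin 1 ⊎ X)) → ∀ c → ∃ (ShortCircuit f c)
shortCircuit-total f c with to f (inj₂ c) in eq
... | inj₂ x    = x , inj₁ refl
... | inj₁ zero with to f (inj₁ zero) in eq′
...   | inj₂ x    = x , inj₂ (refl , refl)
...   | inj₁ zero with () ← trans (sym (from-eq f eq)) (from-eq f eq′)

shortCircuit-sym : (f : (Fin 1 ⊎ C) ↔ (Fin 1 ⊎ X)) → ∀ {c x} →
                   ShortCircuit f c x → ShortCircuit (↔-sym f) x c
shortCircuit-sym f (inj₁ p)       = inj₁ (from-eq f p)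
shortCircuit-sym f (inj₂ (p , q)) = inj₂ (from-eq f q , from-eq f p)

shortCircuit-functional : (f : (Fin 1 ⊎ C) ↔ (Fin 1 ⊎ X)) → ∀ {c x x′} →
                          ShortCircuit f c x → ShortCircuit f c x′ → x ≡ x′
shortCircuit-functional f (inj₁ p)       (inj₁ p′)        = inj₂-injective (trans (sym p) p′)
shortCircuit-functional f (inj₁ p)       (inj₂ (p′ , _))  with () ← trans (sym p) p′
shortCircuit-functional f (inj₂ (p , _)) (inj₁ p′)        with () ← trans (sym p) p′
shortCircuit-functional f (inj₂ (_ , q)) (inj₂ (_ , q′))  = inj₂-injective (trans (sym q) q′)

-- The relation is total and functional, and reversing `f` reverses it; hence it is the graph of a
-- bijection.
shortCircuit : (f : (Fin 1 ⊎ C) ↔ (Fin 1 ⊎ X)) → Σ[ g ∈ C ↔ X ] ∀ c → ShortCircuit f c (to g c)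
shortCircuit f =
  mk↔ₛ′ (proj₁ ∘ shortCircuit-total f) (proj₁ ∘ shortCircuit-total f⁻¹)
    (λ x → shortCircuit-functional f (proj₂ (shortCircuit-total f _))
             (shortCircuit-sym f⁻¹ (proj₂ (shortCircuit-total f⁻¹ x))))
    (λ c → shortCircuit-functional f⁻¹ (proj₂ (shortCircuit-total f⁻¹ _))
             (shortCircuit-sym f (proj₂ (shortCircuit-total f c))))
  , proj₂ ∘ shortCircuit-total f
  where f⁻¹ = ↔-sym f

-- This is where twins enter: when the route passes through the extra point, both ends take the
-- value of that point, which is the same on both sides by hypothesis.
shortCircuit-respects : (f : (Fin 1 ⊎ C) ↔ (Fin 1 ⊎ X)) (P : Fin 1 ⊎ C → Bool) (P′ : Fin 1 ⊎ X → Bool) →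
                        (∀ c → P c ≡ P′ (to f c)) → P (inj₁ zero) ≡ P′ (inj₁ zero) →
                        ∀ {c x} → ShortCircuit f c x → P (inj₂ c) ≡ P′ (inj₂ x)
shortCircuit-respects f P P′ r e (inj₁ p)       = trans (r _) (cong P′ p)
shortCircuit-respects f P P′ r e (inj₂ (p , q)) = begin
  P (inj₂ _)    ≡⟨ trans (r _) (cong P′ p) ⟩
  P′ (inj₁ zero) ≡⟨ e ⟨
  P (inj₁ zero)  ≡⟨ trans (r _) (cong P′ q) ⟩
  P′ (inj₂ _)   ∎
  where open ≡-Reasoning

-- The vertex `a′` would come from some vertex of `A`, but `f` sends all of `A` off `A′`.
¬Preserves₁ : (f : (A ⊎ C) ↔ (A′ ⊎ X)) → A′ → (∀ a → isInj₁ (to f (inj₁ a)) ≡ false) → ¬ Preserves₁ (↔-sym f)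
¬Preserves₁ f a′ p q with from f (inj₁ a′) in eq | q a′
... | inj₁ a | _ with () ← trans (sym (cong isInj₁ (to-eq f eq))) (p a)

-- If an isomorphism moves both blocks off each other, then a first-class vertex of one and a
-- second-class vertex of the other would be both adjacent and non-adjacent.
apart : {E : A → B → Bool} {F : C → D → Bool} {E′ : A′ → B′ → Bool} {F′ : X → Y → Bool}
        (i : E ⊞ F ≃ E′ ⊞ F′) → ∀ u w →
        isInj₁ (to (left i) (inj₁ u)) ≡ false → isInj₁ (from (right i) (inj₁ w)) ≡ false → ⊥
apart i u w p q = true≢false
  (⊞-full (inj₁ u) (from (right i) (inj₁ w)) refl q)
  (trans (respects i _ _) (⊞-empty _ _ p (cong isInj₁ (strictlyInverseˡ (right i) (inj₁ w)))))

-- The two blocks contribute vertices of opposite classes, which is what rules out a pair of points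
-- of the same class. Each block goes wholly into or wholly off the other. If both go in, the
-- isomorphism restricts; if just one does, the given vertices contradict `¬Preserves₁`; if neither
-- does, they contradict `apart`.
cancel-apart : {G : BicolouredGraph k l} {G′ : BicolouredGraph m n} {F : C → D → Bool} {F′ : X → Y → Bool} →
               IsBlock G → IsBlock G′ → (Fin k × Fin n) ⊎ (Fin l × Fin m) →
               edge G ⊞ F ≃ edge G′ ⊞ F′ → edge G ≃ edge G′ × F ≃ F′
cancel-apart block block′ opp i@(rel-iso f g r)
  with block-cut block (pullback-cut i) | block-cut block′ (pullback-cut (≃-sym i)) | opp
... | true  , p , q | true  , p′ , q′ | _ = restrict i p p′ q q′
... | true  , p , q | false , p′ , q′ | inj₁ (u , _) = contradiction p (¬Preserves₁ (↔-sym f) u p′)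
... | true  , p , q | false , p′ , q′ | inj₂ (w , _) = contradiction q (¬Preserves₁ (↔-sym g) w q′)
... | false , p , q | true  , p′ , q′ | inj₁ (_ , w) = contradiction q′ (¬Preserves₁ g w q)
... | false , p , q | true  , p′ , q′ | inj₂ (_ , u) = contradiction p′ (¬Preserves₁ f u p)
... | false , p , q | false , p′ , q′ | inj₁ (u , w) = ⊥-elim (apart i u w (p u) (q′ w))
... | false , p , q | false , p′ , q′ | inj₂ (w , u) = ⊥-elim (apart (≃-sym i) u w (p′ u) (q w))

-- The isomorphism may send the point to a twin inside `F′`, so the first class is short-circuited.
-- The block has no second-class vertex, so there the bijection restricts directly. The `refl`
-- records that the point is joined to all of the rest in both sums.
cancel-point₁ : {E E′ : Fin 1 → Fin 0 → Bool} {F : C → D → Bool} {F′ : X → Y → Bool} →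
                E ⊞ F ≃ E′ ⊞ F′ → E ≃ E′ × F ≃ F′
cancel-point₁ {E = E} {E′} {F} {F′} (rel-iso f g r) =
  let h  , short = shortCircuit f
      g₂ , g₂-eq = restrict₂ g (λ ()) (λ ())
  in  rel-iso (↔-id _) (↔-id _) (λ _ ())
   ,  rel-iso h g₂ λ u w → shortCircuit-respects f
        (λ a → (E ⊞ F) a (inj₂ w)) (λ a → (E′ ⊞ F′) a (inj₂ (to g₂ w)))
        (λ a → trans (r a _) (cong ((E′ ⊞ F′) (to f a)) (g₂-eq w))) refl (short u)

cancel-point₂ : {E E′ : Fin 0 → Fin 1 → Bool} {F : C → D → Bool} {F′ : X → Y → Bool} →
                E ⊞ F ≃ E′ ⊞ F′ → E ≃ E′ × F ≃ F′
cancel-point₂ {E = E} {E′} {F} {F′} (rel-iso f g r) =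
  let h  , short = shortCircuit g
      f₂ , f₂-eq = restrict₂ f (λ ()) (λ ())
  in  rel-iso (↔-id _) (↔-id _) (λ ())
   ,  rel-iso f₂ h λ u w → shortCircuit-respects g
        (λ a → (E ⊞ F) (inj₂ u) a) (λ a → (E′ ⊞ F′) (inj₂ (to f₂ u)) a)
        (λ a → trans (r _ a) (cong (λ c → (E′ ⊞ F′) c (to g a)) (f₂-eq u))) refl (short w)

tangle-vertices : {G : BicolouredGraph m n} → IsTangle G → Fin m × Fin n
tangle-vertices record{ 2≤m = s≤s _ ; 2≤n = s≤s _ } = zero , zero

cancel : {G : BicolouredGraph k l} {G′ : BicolouredGraph m n} {F : C → D → Bool} {F′ : X → Y → Bool} →
         IsBlock G → IsBlock G′ → edge G ⊞ F ≃ edge G′ ⊞ F′ → edge G ≃ edge G′ × F ≃ F′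
cancel (point₁ refl refl) (point₁ refl refl) = cancel-point₁
cancel (point₂ refl refl) (point₂ refl refl) = cancel-point₂
cancel β@(point₁ refl refl) β′@(point₂ refl refl) = cancel-apart β β′ (inj₁ (zero , zero))
cancel β@(point₂ refl refl) β′@(point₁ refl refl) = cancel-apart β β′ (inj₂ (zero , zero))
cancel β@(point₁ refl refl) β′@(tangle t) = cancel-apart β β′ (inj₁ (zero , proj₂ (tangle-vertices t)))
cancel β@(point₂ refl refl) β′@(tangle t) = cancel-apart β β′ (inj₂ (zero , proj₁ (tangle-vertices t)))
cancel β@(tangle t) β′@(point₁ refl refl) = cancel-apart β β′ (inj₂ (proj₂ (tangle-vertices t) , zero))
cancel β@(tangle t) β′@(point₂ refl refl) = cancel-apart β β′ (inj₁ (proj₁ (tangle-vertices t) , zero))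
cancel β@(tangle t) β′@(tangle t′) =
  cancel-apart β β′ (inj₁ (proj₁ (tangle-vertices t) , proj₂ (tangle-vertices t′)))

-- Separating a disconnected incomparability graph

does-true : (P? : Dec X) → does P? ≡ true → X
does-true (yes p) _ = p

does-false : (P? : Dec X) → does P? ≡ false → ¬ X
does-false (no ¬p) _ = ¬p

record Separation (N : A → Pred B 0ℓ) : Set where
  constructor separation
  field
    lower   : A → Bool
    low     : A
    low∈    : lower low ≡ true
    high    : A
    high∉   : lower high ≡ false
    ordered : ∀ {a c} → lower a ≡ true → lower c ≡ false → N a ⊆ N c

module _ {N : Fin k → Pred (Fin l) 0ℓ} (N? : Decidable N) where

  private
    R = Incomparable N

    _⊆?_ : ∀ a c → Dec (N a ⊆ N c)
    a ⊆? c = map′ (λ f {x} → f x) (λ f x → f {x}) (Fin.all? λ x → N? a x →-dec N? c x)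

    walk? : ∀ a c → Dec (Star R a c)
    walk? a c = map′ (reach⇒star R R? (allFin k)) (star⇒reach R R?) (reach? R R? (allFin k) a c)
      where R? = incomparable? N?

    module _ (a : Fin k) where

      -- Otherwise the step from `s` to `d` would prolong the walk from `a`.
      comparable : ∀ {s d} → Star R a s → ¬ Star R a d → N s ⊆ N d ⊎ N d ⊆ N s
      comparable {s} {d} as ¬ad with s ⊆? d | d ⊆? s
      ... | yes p | _     = inj₁ p
      ... | no _  | yes q = inj₂ q
      ... | no p  | no q  = contradiction (as ◅◅ (p , q) ◅ ε) ¬ad

      -- Induction along the walk. If the next vertex `q` had its neighbourhood inside that of `d`,
      -- it would lie inside that of `p` too, although `p` and `q` are incomparable; by `comparable`
      -- it therefore contains that of `d`.
      above : ∀ {d p s} → ¬ Star R a d → Star R a p → Star R p s → N d ⊆ N p → N d ⊆ N s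
      above ¬ad ap ε                  d⊆p = d⊆p
      above ¬ad ap (r@(_ , q⊈p) ◅ qs) d⊆p with comparable (ap ◅◅ r ◅ ε) ¬ad
      ... | inj₁ q⊆d = ⊥-elim (q⊈p λ e → d⊆p (q⊆d e))
      ... | inj₂ d⊆q = above ¬ad (ap ◅◅ r ◅ ε) qs d⊆q

      below : ∀ {d p s} → ¬ Star R a d → Star R a p → Star R p s → N p ⊆ N d → N s ⊆ N d
      below ¬ad ap ε                  p⊆d = p⊆d
      below ¬ad ap (r@(p⊈q , _) ◅ qs) p⊆d with comparable (ap ◅◅ r ◅ ε) ¬ad
      ... | inj₁ q⊆d = below ¬ad (ap ◅◅ r ◅ ε) qs q⊆d
      ... | inj₂ d⊆q = ⊥-elim (p⊈q λ e → d⊆q (p⊆d e))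

      -- By above and below, d lies on one side of the whole component of a.  The lower set excludes
      -- that component if d is below it and includes it if d is above, so twins of a cause no trouble.
      separate : ∀ d → ¬ Star R a d → Separation N
      separate d ¬ad with comparable ε ¬ad
      ... | inj₂ d⊆a = separation (does ∘ P?) d (dec-true (P? d) (¬ad , d⊆a))
                         a (dec-false (P? a) (λ (¬aa , _) → ¬aa ε))
                         λ p q → ordered (does-true (P? _) p) (does-false (P? _) q)
        where
        P : Fin k → Set
        P w = ¬ Star R a w × N w ⊆ N a
        P? : ∀ w → Dec (P w)
        P? w = ¬? (walk? a w) ×-dec (w ⊆? a)
        ordered : ∀ {w s} → P w → ¬ P s → N w ⊆ N s
        ordered {s = s} (¬aw , w⊆a) ¬Ps with walk? a s
        ... | yes as = above ¬aw ε as w⊆a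
        ... | no ¬as with comparable ε ¬as
        ...   | inj₁ a⊆s = λ e → a⊆s (w⊆a e)
        ...   | inj₂ s⊆a = ⊥-elim (¬Ps (¬as , s⊆a))
      ... | inj₁ a⊆d = separation (does ∘ P?) a (dec-true (P? a) (inj₁ ε))
                         d (dec-false (P? d) Sum.[ ¬ad , (λ a⊈d → a⊈d a⊆d) ])
                         λ p q → ordered (does-true (P? _) p) (does-false (P? _) q)
        where
        P : Fin k → Set
        P w = Star R a w ⊎ ¬ (N a ⊆ N w)
        P? : ∀ w → Dec (P w)
        P? w = walk? a w ⊎-dec ¬? (a ⊆? w)
        ordered : ∀ {w s} → P w → ¬ P s → N w ⊆ N s
        ordered {w} {s} Pw ¬Ps with a ⊆? s
        ... | no a⊈s = ⊥-elim (¬Ps (inj₂ a⊈s))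
        ... | yes a⊆s with walk? a w | Pw
        ...   | yes aw | _        = below (¬Ps ∘ inj₁) ε aw a⊆s
        ...   | no ¬aw | inj₁ aw  = contradiction aw ¬aw
        ...   | no ¬aw | inj₂ a⊈w with comparable ε ¬aw
        ...     | inj₁ a⊆w = ⊥-elim (a⊈w a⊆w)
        ...     | inj₂ w⊆a = λ e → a⊆s (w⊆a e)

  connected⊎separated : Connected R ⊎ Separation N
  connected⊎separated with Fin.any? (λ a → Fin.any? λ d → ¬? (walk? a d))
  ... | yes (a , d , ¬ad) = inj₂ (separate a d ¬ad)
  ... | no none           = inj₁ λ a d → decidable-stable (walk? a d) λ ¬ad → none (a , d , ¬ad)

-- Every nonempty graph is a block or has a proper cut

record ProperCut (E : A → B → Bool) : Set where
  field
    side₁   : A → Bool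
    side₂   : B → Bool
    isCut   : IsCut E side₁ side₂
    inside  : (∃ λ u → side₁ u ≡ true)  ⊎ (∃ λ w → side₂ w ≡ true)
    outside : (∃ λ u → side₁ u ≡ false) ⊎ (∃ λ w → side₂ w ≡ false)

open ProperCut

-- The inner first-class vertices are those adjacent to some low vertex. As low neighbourhoods lie
-- inside high ones, they are adjacent to every high vertex, while the remaining ones see no low
-- vertex.
cut₂ : (G : BicolouredGraph m n) → Separation (N₂ G) → ProperCut (edge G)
cut₂ G (separation lower a a∈ c c∉ ordered) = record
  { side₁   = does ∘ reached?
  ; side₂   = lower
  ; isCut   = record
    { full  = λ {u} p q → let _ , r , e = does-true (reached? u) p in T⇒true (ordered r q e)
    ; empty = λ {u} p q → Bool.¬-not λ e → does-false (reached? u) p (_ , q , true⇒T e)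
    }
  ; inside  = inj₂ (a , a∈)
  ; outside = inj₂ (c , c∉)
  }
  where
  reached? : ∀ u → Dec (∃ λ w → lower w ≡ true × T (edge G u w))
  reached? u = Fin.any? λ w → (lower w Bool.≟ true) ×-dec Bool.T? (edge G u w)

-- The negations reflect that in an ordered sum the inner first-class vertices are those with the
-- larger neighbourhoods.
cut₁ : (G : BicolouredGraph m n) → Separation (N₁ G) → ProperCut (edge G)
cut₁ G (separation lower a a∈ c c∉ ordered) = record
  { side₁   = not ∘ lower
  ; side₂   = not ∘ does ∘ reached?
  ; isCut   = record
    { full  = λ {_} {w} p q → let _ , r , e = does-true (reached? w) (Bool.not-injective q)
                              in T⇒true (ordered r (Bool.not-injective p) e)
    ; empty = λ {_} {w} p q → Bool.¬-not λ e →
                does-false (reached? w) (Bool.not-injective q) (_ , Bool.not-injective p , true⇒T e)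
    }
  ; inside  = inj₁ (c , cong not c∉)
  ; outside = inj₁ (a , cong not a∈)
  }
  where
  reached? : ∀ w → Dec (∃ λ u → lower u ≡ true × T (edge G u w))
  reached? w = Fin.any? λ u → (lower u Bool.≟ true) ×-dec Bool.T? (edge G u w)

-- A first-class vertex joined to everything splits off in front as a point; `other` keeps the
-- remainder nonempty. Dually, `isolated-cut` splits off a second-class vertex joined to nothing.
full-cut : (G : BicolouredGraph m n) → ∀ u → (∀ w → edge G u w ≡ true) →
           (∃ λ v → v ≢ u) ⊎ Fin n → ProperCut (edge G)
full-cut G u all other = record
  { side₁   = λ v → does (v Fin.≟ u)
  ; side₂   = λ _ → false
  ; isCut   = record
    { full  = λ {v} p _ → subst (λ v → edge G v _ ≡ true) (sym (does-true (v Fin.≟ u) p)) (all _)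
    ; empty = λ _ ()
    }
  ; inside  = inj₁ (u , dec-true (u Fin.≟ u) refl)
  ; outside = Sum.map (λ (v , v≢u) → v , dec-false (v Fin.≟ u) v≢u) (λ w → w , refl) other
  }

isolated-cut : (G : BicolouredGraph m n) → ∀ w → (∀ u → edge G u w ≡ false) →
               (∃ λ v → v ≢ w) ⊎ Fin m → ProperCut (edge G)
isolated-cut G w none other = record
  { side₁   = λ _ → false
  ; side₂   = λ v → does (v Fin.≟ w)
  ; isCut   = record
    { full  = λ ()
    ; empty = λ {_} {v} _ q → subst (λ v → edge G _ v ≡ false) (sym (does-true (v Fin.≟ w) q)) (none _)
    }
  ; inside  = inj₂ (w , dec-true (w Fin.≟ w) refl)
  ; outside = Sum.swap (Sum.map (λ (v , v≢w) → v , dec-false (v Fin.≟ w) v≢w) (λ u → u , refl) other)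
  }

block⊎cut : (G : BicolouredGraph m n) → Fin m ⊎ Fin n → IsBlock G ⊎ ProperCut (edge G)
block⊎cut {0} {0} G (inj₁ ())
block⊎cut {0} {0} G (inj₂ ())
block⊎cut {1} {0} G _ = inj₁ (point₁ refl refl)
block⊎cut {0} {1} G _ = inj₁ (point₂ refl refl)
block⊎cut {suc (suc m)} {0} G _ = inj₂ (full-cut G zero (λ ()) (inj₁ (suc zero , λ ())))
block⊎cut {0} {suc (suc n)} G _ = inj₂ (isolated-cut G zero (λ ()) (inj₁ (suc zero , λ ())))
block⊎cut {suc m} {suc n} G _
  with Fin.any? (λ u → Fin.all? λ w → edge G u w Bool.≟ true)
     | Fin.any? (λ w → Fin.all? λ u → edge G u w Bool.≟ false)
... | yes (u , all) | _ = inj₂ (full-cut G u all (inj₂ zero))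
... | no _ | yes (w , none) = inj₂ (isolated-cut G w none (inj₂ zero))
... | no ¬full | no ¬isolated
    with connected⊎separated (λ w u → Bool.T? (edge G u w))
       | connected⊎separated (λ u w → Bool.T? (edge G u w))
...   | inj₂ s | _      = inj₂ (cut₂ G s)
...   | inj₁ _ | inj₂ s = inj₂ (cut₁ G s)
...   | inj₁ c | inj₁ d = inj₁ (tangle record
  { 2≤m = size₁ G ¬full ¬isolated ; 2≤n = size₂ G ¬full ¬isolated ; con₂ = c ; con₁ = d })
  where
  -- A sole first-class vertex is either joined to everything or misses some second-class vertex,
  -- which is then isolated. `size₂` is dual.
  size₁ : ∀ {m n} (G : BicolouredGraph (suc m) n) →
          ¬ (∃ λ u → ∀ w → edge G u w ≡ true) → ¬ (∃ λ w → ∀ u → edge G u w ≡ false) → 2 ≤ suc m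
  size₁ {suc m} _ _     _         = s≤s (s≤s z≤n)
  size₁ {zero}  G ¬full ¬isolated =
    ⊥-elim (¬full (zero , λ w → Bool.¬-not λ e → ¬isolated (w , λ { zero → e })))
  size₂ : ∀ {m n} (G : BicolouredGraph m (suc n)) →
          ¬ (∃ λ u → ∀ w → edge G u w ≡ true) → ¬ (∃ λ w → ∀ u → edge G u w ≡ false) → 2 ≤ suc n
  size₂ {n = suc n} _ _     _         = s≤s (s≤s z≤n)
  size₂ {n = zero}  G ¬full ¬isolated =
    ⊥-elim (¬isolated (zero , λ u → Bool.¬-not λ e → ¬full (u , λ { zero → e })))

-- Splitting along a cut and extracting the first block

-- Renumbers the two fibres of `S`, so that the two parts of a cut are again graphs on `Fin`.
record Partition (S : Fin m → Bool) : Set where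
  field
    #in #out  : ℕ
    merge     : (Fin #in ⊎ Fin #out) ↔ Fin m
    merge-in  : ∀ x → S (to merge (inj₁ x)) ≡ true
    merge-out : ∀ y → S (to merge (inj₂ y)) ≡ false

open Partition

suc⊎↔ : (Fin k ⊎ Fin l) ↔ Fin m → (Fin (suc k) ⊎ Fin l) ↔ Fin (suc m)
suc⊎↔ f = ↔-sym Fin.+↔⊎ ↔-∘ ((↔-id (Fin 1) ⊎-↔ f) ↔-∘ (⊎-assoc 0ℓ _ _ _ ↔-∘ (Fin.+↔⊎ ⊎-↔ ↔-id _)))

⊎suc↔ : (Fin k ⊎ Fin l) ↔ Fin m → (Fin k ⊎ Fin (suc l)) ↔ Fin (suc m)
⊎suc↔ f = suc⊎↔ (f ↔-∘ ⊎-comm _ _) ↔-∘ ⊎-comm _ _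

partition : (S : Fin m → Bool) → Partition S
partition {zero}  S = record { #in = 0 ; #out = 0 ; merge = ↔-sym Fin.+↔⊎ ; merge-in = λ () ; merge-out = λ () }
partition {suc m} S with S zero in eq | partition (S ∘ suc)
... | true  | p = record
  { #in = suc (#in p) ; #out = #out p ; merge = suc⊎↔ (merge p)
  ; merge-in = λ { zero → eq ; (suc x) → merge-in p x } ; merge-out = merge-out p }
... | false | p = record
  { #in = #in p ; #out = suc (#out p) ; merge = ⊎suc↔ (merge p)
  ; merge-in = merge-in p ; merge-out = λ { zero → eq ; (suc y) → merge-out p y } }

⊎↔⇒+≡ : (Fin k ⊎ Fin l) ↔ Fin m → k + l ≡ m
⊎↔⇒+≡ f = ↔⇒≡ (f ↔-∘ Fin.+↔⊎)

module _ {G : BicolouredGraph m n} (c : ProperCut (edge G)) where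

  private
    p₁ = partition (side₁ c)
    p₂ = partition (side₂ c)

  inner : BicolouredGraph (#in p₁) (#in p₂)
  inner = graph λ u w → edge G (to (merge p₁) (inj₁ u)) (to (merge p₂) (inj₁ w))

  outer : BicolouredGraph (#out p₁) (#out p₂)
  outer = graph λ u w → edge G (to (merge p₁) (inj₂ u)) (to (merge p₂) (inj₂ w))

  inner⊞outer : edge inner ⊞ edge outer ≃ edge G
  inner⊞outer = rel-iso (merge p₁) (merge p₂) λ where
    (inj₁ u) (inj₁ w) → refl
    (inj₁ u) (inj₂ w) → sym (full (isCut c) (merge-in p₁ u) (merge-out p₂ w))
    (inj₂ u) (inj₁ w) → sym (empty (isCut c) (merge-out p₁ u) (merge-in p₂ w))
    (inj₂ u) (inj₂ w) → refl

in-nonempty : {S : Fin m → Bool} (p : Partition S) → (∃ λ u → S u ≡ true) → Fin (#in p)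
in-nonempty {S = S} p (u , e) with from (merge p) u in eq
... | inj₁ x = x
... | inj₂ y = true≢false e (trans (cong S (sym (to-eq (merge p) eq))) (merge-out p y))

out-nonempty : {S : Fin m → Bool} (p : Partition S) → (∃ λ u → S u ≡ false) → Fin (#out p)
out-nonempty {S = S} p (u , e) with from (merge p) u in eq
... | inj₂ y = y
... | inj₁ x = true≢false (trans (cong S (sym (to-eq (merge p) eq))) (merge-in p x)) e

Fin⇒< : ∀ {m k} → Fin k → m < m + k
Fin⇒< {m} {suc k} _ = ℕ.m<m+n m ℕ.z<s

smaller : k + k′ ≡ m → l + l′ ≡ n → Fin k′ ⊎ Fin l′ → k + l < m + n
smaller {k} {k′} {l = l} {l′} refl refl (inj₁ x) = ℕ.+-mono-<-≤ (Fin⇒< x) (ℕ.m≤m+n l l′)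
smaller {k} {k′} {l = l} {l′} refl refl (inj₂ y) = ℕ.+-mono-≤-< (ℕ.m≤m+n k k′) (Fin⇒< y)

record Decomposition (G : BicolouredGraph m n) : Set where
  constructor decomposition
  field
    {k₁ l₁ k₂ l₂} : ℕ
    {first} : BicolouredGraph k₁ l₁
    {rest}  : BicolouredGraph k₂ l₂
    isBlock : IsBlock first
    sum≃    : edge first ⊞ edge rest ≃ edge G

-- When G has a proper cut, the first block of its inner part is also the first block of G.
decompose : (G : BicolouredGraph m n) → Fin m ⊎ Fin n → Acc _<_ (m + n) → Decomposition G
decompose G nonempty (acc rec) with block⊎cut G nonempty
-- A block is its own first block, followed by the empty graph.
... | inj₁ β = decomposition {rest = graph {0} {0} λ ()} β
  (rel-iso ⊎0↔ ⊎0↔ λ { (inj₁ _) (inj₁ _) → refl })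
  where
  ⊎0↔ : (Fin k ⊎ Fin 0) ↔ Fin k
  ⊎0↔ = mk↔ₛ′ (λ { (inj₁ x) → x ; (inj₂ ()) }) inj₁ (λ _ → refl) λ { (inj₁ _) → refl ; (inj₂ ()) }
... | inj₂ c =
  let p₁ = partition (side₁ c)
      p₂ = partition (side₂ c)
      decomposition {rest = H} β i = decompose (inner c)
        (Sum.map (in-nonempty p₁) (in-nonempty p₂) (inside c))
        (rec (smaller (⊎↔⇒+≡ (merge p₁)) (⊎↔⇒+≡ (merge p₂))
               (Sum.map (out-nonempty p₁) (out-nonempty p₂) (outside c))))
  in decomposition {rest = H ⊕ outer c} β
       (≃-trans (⊞-cong ≃-refl (⊕≃⊞ H (outer c)))
       (≃-trans (≃-sym (⊞-assoc _ _ _))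
       (≃-trans (⊞-cong i ≃-refl) (inner⊞outer c))))

-- Counting isomorphism classes

-- Each representative listed by `f` is sent to an index of its class under `g`; equal indices mean
-- equivalent representatives, so this map is injective.
HasSize-≤ : (S : Setoid 0ℓ 0ℓ) → HasSize S k → HasSize S l → k ≤ l
HasSize-≤ S f g = Fin.injective⇒≤ {f = λ x → proj₁ (preimage x)} λ {x} {y} e →
  Bijection.injective f (Setoid.trans S (Setoid.sym S (proj₂ (preimage x)))
    (Setoid.trans S (Bijection.cong g e) (proj₂ (preimage y))))
  where preimage = λ x → Bijection.strictlySurjective g (Bijection.to f x)

HasSize-unique : (S : Setoid 0ℓ 0ℓ) → HasSize S k → HasSize S l → k ≡ l
HasSize-unique S f g = ℕ.≤-antisym (HasSize-≤ S f g) (HasSize-≤ S g f)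

HasSize-empty : (S : Setoid 0ℓ 0ℓ) → ¬ Setoid.Carrier S → HasSize S k → k ≡ 0
HasSize-empty {zero}  S ¬S f = refl
HasSize-empty {suc k} S ¬S f = contradiction (Bijection.to f zero) ¬S

HasSize-singleton : (S : Setoid 0ℓ 0ℓ) → Setoid.Carrier S → (∀ x y → Setoid._≈_ S x y) → HasSize S 1
HasSize-singleton S x all = record
  { to        = λ _ → x
  ; cong      = λ _ → Setoid.refl S
  ; bijective = (λ { {zero} {zero} _ → refl }) , λ y → zero , λ _ → all x y
  }

HasSize-↔ : (S : Setoid 0ℓ 0ℓ) → let open Setoid S in
            Fin k ↔ C → (f : C → Carrier) → (∀ {x y} → f x ≈ f y → x ≡ y) →
            (∀ y → ∃ λ x → f x ≈ y) → HasSize S k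
HasSize-↔ S c f injective surjective = record
  { to        = f ∘ to c
  ; cong      = λ { refl → Setoid.refl S }
  ; bijective = (λ {x} {y} e → trans (sym (strictlyInverseʳ c x)) (from-eq c (sym (injective e))))
              , λ y → let x , e = surjective y in
                  from c x , λ { refl → subst (λ x → Setoid._≈_ S (f x) y) (sym (strictlyInverseˡ c x)) e }
  }

blockSetoid : ℕ → ℕ → Setoid 0ℓ 0ℓ
blockSetoid m n = On.setoid {B = Σ (BicolouredGraph m n) IsBlock} (graphSetoid m n) proj₁

tangles⇒blocks : ¬ (m ≡ 1 × n ≡ 0) → ¬ (m ≡ 0 × n ≡ 1) →
                 HasSize (tangleSetoid m n) k → HasSize (blockSetoid m n) k
tangles⇒blocks ¬x ¬y f = record
  { to        = λ c → let G , t = Bijection.to f c in G , tangle t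
  ; cong      = Bijection.cong f
  ; bijective = Bijection.injective f , λ where
      (G , point₁ p q) → contradiction (p , q) ¬x
      (G , point₂ p q) → contradiction (p , q) ¬y
      (G , tangle t)   → Bijection.surjective f (G , t)
  }

-- The coefficients of x + y + T as natural numbers. Overriding `τ` at the two point sizes loses
-- nothing, since a tangle needs two vertices in each class.
β : ℕ → ℕ → ℕ
β 1 0 = 1
β 0 1 = 1
β k l = τ k l

countBlocks : ∀ k l → HasSize (blockSetoid k l) (β k l)
countBlocks 1 0 = HasSize-singleton (blockSetoid 1 0) (graph (λ _ ()) , point₁ refl refl)
  λ _ _ → ≃⇒≅ (rel-iso (↔-id _) (↔-id _) λ _ ())
countBlocks 0 1 = HasSize-singleton (blockSetoid 0 1) (graph (λ ()) , point₂ refl refl)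
  λ _ _ → ≃⇒≅ (rel-iso (↔-id _) (↔-id _) λ ())
-- The sizes are split just far enough for `β` to reduce to `τ`.
countBlocks 0 0             = tangles⇒blocks (λ ()) (λ ()) (proj₂ (countTangles 0 0))
countBlocks 0 (suc (suc l)) = tangles⇒blocks (λ ()) (λ ()) (proj₂ (countTangles 0 (suc (suc l))))
countBlocks 1 (suc l)       = tangles⇒blocks (λ ()) (λ ()) (proj₂ (countTangles 1 (suc l)))
countBlocks (suc (suc k)) l = tangles⇒blocks (λ ()) (λ ()) (proj₂ (countTangles (suc (suc k)) l))

τ-small : ∀ k l → k < 2 ⊎ l < 2 → τ k l ≡ 0
τ-small k l small = HasSize-empty (tangleSetoid k l) (λ (_ , t) → ¬tangle t small) (proj₂ (countTangles k l))
  where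
  ¬tangle : {G : BicolouredGraph k l} → IsTangle G → ¬ (k < 2 ⊎ l < 2)
  ¬tangle t (inj₁ k<2) = ℕ.<⇒≱ k<2 (2≤m t)
  ¬tangle t (inj₂ l<2) = ℕ.<⇒≱ l<2 (2≤n t)

Blocks-coefficient : ∀ k l → xˢ k l ℤ.+ yˢ k l ℤ.+ Tunl k l ≡ + β k l
Blocks-coefficient 0 0             = ℤ.+-identityˡ _
Blocks-coefficient 0 1             = cong (λ t → 1ℤ ℤ.+ + t) (τ-small 0 1 (inj₁ (s≤s z≤n)))
Blocks-coefficient 0 (suc (suc l)) = ℤ.+-identityˡ _
Blocks-coefficient 1 0             = cong (λ t → 1ℤ ℤ.+ + t) (τ-small 1 0 (inj₂ (s≤s z≤n)))
Blocks-coefficient 1 (suc l)       = ℤ.+-identityˡ _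
Blocks-coefficient (suc (suc k)) l = ℤ.+-identityˡ _

-- The recurrence for the number of graphs

sum↔Σ : (c : Fin n → ℕ) → Fin (sumℕ c) ↔ Σ (Fin n) (Fin ∘ c)
sum↔Σ {zero}  c = mk↔ₛ′ (λ ()) (λ ()) (λ ()) (λ ())
sum↔Σ {suc n} c = mk↔ₛ′
  (λ { (inj₁ x) → zero , x ; (inj₂ (k , x)) → suc k , x })
  (λ { (zero , x) → inj₁ x ; (suc k , x) → inj₂ (k , x) })
  (λ { (zero , x) → refl ; (suc k , x) → refl })
  (λ { (inj₁ x) → refl ; (inj₂ (k , x)) → refl })
  ↔-∘ ((↔-id _ ⊎-↔ sum↔Σ (c ∘ suc)) ↔-∘ Fin.+↔⊎)

edge-subst₂ : (p : m ≡ m′) (q : n ≡ n′) (G : BicolouredGraph m n) →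
              edge (subst₂ BicolouredGraph p q G) ≃ edge G
edge-subst₂ refl refl G = ≃-refl

module _ (i j : ℕ) where

  -- One code for each choice of sizes, block class and class of the remainder, so that codes are
  -- counted by a coefficient of (x + y + T) B.
  Code : Set
  Code = Σ[ k ∈ Fin (suc i) ] Σ[ l ∈ Fin (suc j) ]
         Fin (β (toℕ k) (toℕ l)) × Fin (b (i ∸ toℕ k) (j ∸ toℕ l))

  codeCount : ℕ
  codeCount = sumℕ {suc i} λ k → sumℕ {suc j} λ l → β (toℕ k) (toℕ l) ℕ.* b (i ∸ toℕ k) (j ∸ toℕ l)

  code↔ : Fin codeCount ↔ Code
  code↔ = Σ-↔ (↔-id _) (Σ-↔ (↔-id _) Fin.*↔× ↔-∘ sum↔Σ _) ↔-∘ sum↔Σ _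

  module _ (k : Fin (suc i)) (l : Fin (suc j)) where

    assemble : BicolouredGraph (toℕ k) (toℕ l) → BicolouredGraph (i ∸ toℕ k) (j ∸ toℕ l) →
               BicolouredGraph i j
    assemble G H = subst₂ BicolouredGraph
      (ℕ.m+[n∸m]≡n (Fin.toℕ≤pred[n] k)) (ℕ.m+[n∸m]≡n (Fin.toℕ≤pred[n] l)) (G ⊕ H)

    assemble≃ : ∀ G H → edge (assemble G H) ≃ edge G ⊞ edge H
    assemble≃ G H = ≃-trans
      (edge-subst₂ (ℕ.m+[n∸m]≡n (Fin.toℕ≤pred[n] k)) (ℕ.m+[n∸m]≡n (Fin.toℕ≤pred[n] l)) (G ⊕ H)) (⊕≃⊞ G H)

    block : Fin (β (toℕ k) (toℕ l)) → Σ (BicolouredGraph (toℕ k) (toℕ l)) IsBlock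
    block = Bijection.to (countBlocks (toℕ k) (toℕ l))

    remainder : Fin (b (i ∸ toℕ k) (j ∸ toℕ l)) → BicolouredGraph (i ∸ toℕ k) (j ∸ toℕ l)
    remainder = Bijection.to (proj₂ (countGraphs (i ∸ toℕ k) (j ∸ toℕ l)))

  decodeSum : Code → BicolouredGraph i j
  decodeSum (k , l , p , q) = assemble k l (proj₁ (block k l p)) (remainder k l q)

  code-≡ : ∀ {k k′ l l′ p p′ q q′} → k ≡ k′ → l ≡ l′ →
           edge (proj₁ (block k l p)) ≃ edge (proj₁ (block k′ l′ p′)) →
           edge (remainder k l q) ≃ edge (remainder k′ l′ q′) →
           _≡_ {A = Code} (k , l , p , q) (k′ , l′ , p′ , q′)
  code-≡ {k} {l = l} refl refl e e′ = cong₂ (λ p q → k , l , p , q)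
    (Bijection.injective (countBlocks _ _) (≃⇒≅ e))
    (Bijection.injective (proj₂ (countGraphs _ _)) (≃⇒≅ e′))

  -- The two codes may a priori carry different sizes. The bijections delivered by `cancel` force
  -- the sizes to agree, and only then can the class indices be compared.
  decodeSum-injective : ∀ {c c′} → decodeSum c ≅ decodeSum c′ → c ≡ c′
  decodeSum-injective {k , l , p , q} {k′ , l′ , p′ , q′} e =
    let first , rest = cancel (proj₂ (block k l p)) (proj₂ (block k′ l′ p′))
          (≃-trans (≃-sym (assemble≃ k l _ _)) (≃-trans (≅⇒≃ e) (assemble≃ k′ l′ _ _)))
    in code-≡ (Fin.toℕ-injective (↔⇒≡ (left first)))
              (Fin.toℕ-injective (↔⇒≡ (right first))) first rest

  -- The sizes are tied to `k` and `l` by equations between variables; matching these gives the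
  -- parts exactly the types that the counting bijections expect.
  encodeSum : ∀ {k₁ l₁ k₂ l₂} (k : Fin (suc i)) (l : Fin (suc j)) →
              toℕ k ≡ k₁ → toℕ l ≡ l₁ → i ∸ toℕ k ≡ k₂ → j ∸ toℕ l ≡ l₂ →
              {G : BicolouredGraph k₁ l₁} {H : BicolouredGraph k₂ l₂} → IsBlock G →
              Σ[ c ∈ Code ] edge (decodeSum c) ≃ edge G ⊞ edge H
  encodeSum k l refl refl refl refl {G} {H} isBlock =
    let p , p≅ = Bijection.strictlySurjective (countBlocks (toℕ k) (toℕ l)) (G , isBlock)
        q , q≅ = Bijection.strictlySurjective (proj₂ (countGraphs (i ∸ toℕ k) (j ∸ toℕ l))) H
    in (k , l , p , q) , ≃-trans (assemble≃ k l _ _) (⊞-cong (≅⇒≃ p≅) (≅⇒≃ q≅))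

  decodeSum-surjective : Fin i ⊎ Fin j → ∀ G → Σ[ c ∈ Code ] decodeSum c ≅ G
  decodeSum-surjective nonempty G =
    let decomposition isBlock sum≃ = decompose G nonempty (<-wellFounded _)
        k , k≡ , k∸ = position (⊎↔⇒+≡ (left sum≃))
        l , l≡ , l∸ = position (⊎↔⇒+≡ (right sum≃))
        c , c≃ = encodeSum k l k≡ l≡ k∸ l∸ isBlock
    in c , ≃⇒≅ (≃-trans c≃ sum≃)
    where
    position : ∀ {k k′ i} → k + k′ ≡ i → Σ[ c ∈ Fin (suc i) ] toℕ c ≡ k × i ∸ toℕ c ≡ k′
    position {k} {k′} refl = fromℕ< k<1+i , Fin.toℕ-fromℕ< k<1+i ,
      trans (cong (k + k′ ∸_) (Fin.toℕ-fromℕ< k<1+i)) (ℕ.m+n∸m≡n k k′)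
      where k<1+i = s≤s (ℕ.m≤m+n k k′)

  -- The empty graph has no first block, whence the nonemptiness condition; it accounts for the
  -- constant term 1 in the series identity.
  b-recurrence : Fin i ⊎ Fin j → b i j ≡ codeCount
  b-recurrence nonempty = HasSize-unique (graphSetoid i j) (proj₂ (countGraphs i j))
    (HasSize-↔ (graphSetoid i j) code↔ decodeSum decodeSum-injective (decodeSum-surjective nonempty))

b₀₀ : b 0 0 ≡ 1
b₀₀ = HasSize-unique (graphSetoid 0 0) (proj₂ (countGraphs 0 0))
  (HasSize-singleton (graphSetoid 0 0) (graph λ ()) λ _ _ → ≃⇒≅ (rel-iso (↔-id _) (↔-id _) λ ()))

-- Passage to power series and inversion

Blocks : Series
Blocks i j = + β i j

+-sum : (c : Fin n → ℕ) → + sumℕ c ≡ sum (λ k → + c k)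
+-sum {zero}  c = refl
+-sum {suc n} c = cong (ℤ._+_ (+ c zero)) (+-sum (c ∘ suc))

codeCount-*ˢ : ∀ i j → + codeCount i j ≡ (Blocks *ˢ Bunl) i j
codeCount-*ˢ i j = trans (+-sum {suc i} λ k → sumℕ {suc j} (term k)) (sum-cong-≗ {suc i} λ k →
  trans (+-sum {suc j} (term k)) (sum-cong-≗ {suc j} λ l →
    ℤ.pos-* (β (toℕ k) (toℕ l)) (b (i ∸ toℕ k) (j ∸ toℕ l))))
  where
  term : Fin (suc i) → Fin (suc j) → ℕ
  term k l = β (toℕ k) (toℕ l) ℕ.* b (i ∸ toℕ k) (j ∸ toℕ l)

Bunl-recurrence : ∀ i j → 1ˢ i j ℤ.+ (Blocks *ˢ Bunl) i j ≡ Bunl i j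
-- The only product term is `τ 0 0` times `b 0 0`, which vanishes; the 1 counts the empty graph.
Bunl-recurrence zero    zero    = begin
  1ℤ ℤ.+ (Blocks *ˢ Bunl) 0 0       ≡⟨ cong (ℤ._+_ 1ℤ) (codeCount-*ˢ 0 0) ⟨
  1ℤ ℤ.+ + codeCount 0 0          ≡⟨ cong (λ t → 1ℤ ℤ.+ + (t ℕ.* b 0 0 + 0 + 0))
                                             (τ-small 0 0 (inj₁ (s≤s z≤n))) ⟩
  1ℤ                              ≡⟨ cong +_ b₀₀ ⟨
  Bunl 0 0                        ∎
  where open ≡-Reasoning
Bunl-recurrence zero    (suc j) = trans (ℤ.+-identityˡ _)
  (trans (sym (codeCount-*ˢ 0 (suc j))) (cong +_ (sym (b-recurrence 0 (suc j) (inj₂ zero)))))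
Bunl-recurrence (suc i) j       = trans (ℤ.+-identityˡ _)
  (trans (sym (codeCount-*ˢ (suc i) j)) (cong +_ (sym (b-recurrence (suc i) j (inj₁ zero)))))

-- Both summation indices are reversed, which exchanges the degrees taken by the two factors.
*ˢ-comm : ∀ F G → F *ˢ G ≈ˢ G *ˢ F
*ˢ-comm F G i j =
  trans (sum-permute {suc i} (λ k → sum {suc j} (term k)) reverse) (sum-cong-≗ {suc i} λ k →
  trans (sum-permute {suc j} (term (opposite k)) reverse) (sum-cong-≗ {suc j} λ l →
  trans (ℤ.*-comm (F (toℕ (opposite k)) (toℕ (opposite l))) (G (i ∸ toℕ (opposite k)) (j ∸ toℕ (opposite l))))
        (cong₂ ℤ._*_ (cong₂ G (∸-opposite k) (∸-opposite l)) (cong₂ F (Fin.opposite-prop k) (Fin.opposite-prop l)))))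
  where
  term : Fin (suc i) → Fin (suc j) → ℤ
  term k l = F (toℕ k) (toℕ l) ℤ.* G (i ∸ toℕ k) (j ∸ toℕ l)
  ∸-opposite : ∀ {n} (k : Fin (suc n)) → n ∸ toℕ (opposite k) ≡ toℕ k
  ∸-opposite {n} k = trans (cong (n ∸_) (Fin.opposite-prop k)) (ℕ.m∸[m∸n]≡n (Fin.toℕ≤pred[n] k))

*ˢ-identityˡ : ∀ F → 1ˢ *ˢ F ≈ˢ F
*ˢ-identityˡ F i j = begin
  -- By computation, every term but the one at degree (0,0) of `1ˢ` is already zero.
  (1ℤ ℤ.* F i j ℤ.+ sum {j} (λ l → 0ℤ)) ℤ.+ sum {i} (λ k → 0ℤ ℤ.+ sum {j} (λ l → 0ℤ))
    ≡⟨ cong₂ ℤ._+_ (cong₂ ℤ._+_ (ℤ.*-identityˡ (F i j)) (sum-replicate-zero j))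
         (trans (sum-cong-≗ {i} λ _ → trans (ℤ.+-identityˡ _) (sum-replicate-zero j)) (sum-replicate-zero i)) ⟩
  (F i j ℤ.+ 0ℤ) ℤ.+ 0ℤ ≡⟨ trans (ℤ.+-identityʳ _) (ℤ.+-identityʳ _) ⟩
  F i j ∎
  where open ≡-Reasoning

-- The sum of the series enters as `K` with a pointwise equation, so that it can be taken to be `1ˢ`
-- at once.
*ˢ-distribʳ : ∀ F G H {K} → (∀ i j → F i j ℤ.+ G i j ≡ K i j) →
              ∀ i j → (F *ˢ H) i j ℤ.+ (G *ˢ H) i j ≡ (K *ˢ H) i j
*ˢ-distribʳ F G H F+G≡K i j =
  trans (sym (∑-distrib-+ {suc i} (λ k → sum {suc j} (term F k)) (λ k → sum {suc j} (term G k))))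
  (sum-cong-≗ {suc i} λ k →
  trans (sym (∑-distrib-+ {suc j} (term F k) (term G k))) (sum-cong-≗ {suc j} λ l →
  trans (sym (ℤ.*-distribʳ-+ (H (i ∸ toℕ k) (j ∸ toℕ l)) (F (toℕ k) (toℕ l)) (G (toℕ k) (toℕ l))))
        (cong (ℤ._* H (i ∸ toℕ k) (j ∸ toℕ l)) (F+G≡K (toℕ k) (toℕ l)))))
  where
  term : Series → Fin (suc i) → Fin (suc j) → ℤ
  term F k l = F (toℕ k) (toℕ l) ℤ.* H (i ∸ toℕ k) (j ∸ toℕ l)

-- The inverse is defined by the value that the theorem predicts and then verified.
Bunl⁻¹ : Series
Bunl⁻¹ = 1ˢ -ˢ xˢ -ˢ yˢ -ˢ Tunl

Bunl⁻¹+Blocks : ∀ i j → Bunl⁻¹ i j ℤ.+ Blocks i j ≡ 1ˢ i j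
Bunl⁻¹+Blocks i j = trans (cong (ℤ._+_ (Bunl⁻¹ i j)) (sym (Blocks-coefficient i j)))
  (cancelled (1ˢ i j) (xˢ i j) (yˢ i j) (Tunl i j))
  where
  cancelled : ∀ o x y t → o ℤ.- x ℤ.- y ℤ.- t ℤ.+ (x ℤ.+ y ℤ.+ t) ≡ o
  cancelled = solve-∀

-- Adding `Blocks *ˢ Bunl` to the left side gives 1 · B, and to the right side gives 1 + (x + y + T)
-- B; these agree by the recurrence.
inverseˡ : Bunl⁻¹ *ˢ Bunl ≈ˢ 1ˢ
inverseˡ i j = +-cancelʳ ((Blocks *ˢ Bunl) i j) _ _ (begin
  (Bunl⁻¹ *ˢ Bunl) i j ℤ.+ (Blocks *ˢ Bunl) i j ≡⟨ *ˢ-distribʳ Bunl⁻¹ Blocks Bunl Bunl⁻¹+Blocks i j ⟩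
  (1ˢ *ˢ Bunl) i j                            ≡⟨ *ˢ-identityˡ Bunl i j ⟩
  Bunl i j                                    ≡⟨ Bunl-recurrence i j ⟨
  1ˢ i j ℤ.+ (Blocks *ˢ Bunl) i j               ∎)
  where open ≡-Reasoning

theorem4p2 : Σ[ (Bunl⁻¹ , _) ∈ Invertible 1ˢ _*ˢ_ Bunl ] Tunl ≈ˢ 1ˢ -ˢ xˢ -ˢ yˢ -ˢ Bunl⁻¹
theorem4p2 = (Bunl⁻¹ , inverseˡ , λ i j → trans (*ˢ-comm Bunl Bunl⁻¹ i j) (inverseˡ i j))
           -- With c the coefficient of 1 - x - y, the inverse has coefficient c - t, so the claim
           -- becomes t = c - (c - t).
           , λ i j → double-minus (1ˢ i j ℤ.- xˢ i j ℤ.- yˢ i j) (Tunl i j)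
  where
  double-minus : ∀ c t → t ≡ c ℤ.- (c ℤ.- t)
  double-minus = solve-∀
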